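{- Let $k\ge 2$ be even, let $\alpha_1,\dots,\alpha_k$ be positive integers with $n=\alpha_1+\cdots+\alpha_k$, let $G=C(\alpha_1,\dots,\alpha_k)$, and let $Q_L$ be the quotient matrix of its Laplacian with respect to the partition $\pi=\{\pi_1,\dots,\pi_k\}$. Then the eigenvalues of $Q_L$, listed as $\lambda_1\le\lambda_2\le\cdots\le\lambda_k$, are determined by $\lambda_1=0$, $\lambda_k=n$ and $$\lambda_i=\lambda_{i-1}+\alpha_{k-2(i-2)}\quad (i=2,3,\dots,\tfrac{k}{2}),\qquad \lambda_i=\lambda_{i+1}-\alpha_{2i-(k-1)}\quad (i=k-1,k-2,\dots,\tfrac{k}{2}+1).$$ (Explicitly, $\lambda_i=\alpha_k+\alpha_{k-2}+\cdots+\alpha_{k-2i+4}$ for $2\le i\le k/2$, and $\lambda_{k/2+i}=\sum_{l=1}^{k/2}\alpha_{2l}+\sum_{m=1}^{i}\alpha_{2m-1}$ for $1\le i\le k/2$.) Each of these is also a Laplacian eigenvalue of $G$.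
   Context: For positive integers $\alpha_1,\dots,\alpha_k$, the graph $C(\alpha_1,\dots,\alpha_k)$ is defined recursively by $C(\alpha_1)=\overline{K_{\alpha_1}}$ (the edgeless graph on $\alpha_1$ vertices) and $C(\alpha_1,\dots,\alpha_i)=\overline{C(\alpha_1,\dots,\alpha_{i-1})\cup K_{\alpha_i}}$ for $i=2,\dots,k$, where $\cup$ is disjoint union and the bar denotes graph complement. Let $\pi_i$ be the set of $\alpha_i$ vertices introduced at step $i$ (for $i=1$, the vertices of $C(\alpha_1)$). When $k$ is even (standing assumption), equivalently: $\pi_i$ induces a clique if $i$ is odd and an independent set if $i$ is even, and for $i<j$ a vertex of $\pi_i$ and a vertex of $\pi_j$ are adjacent iff $j$ is even. Such graphs (with $k$ even) are called $\mathcal{C}$-graphs. $L=D-A$ is the Laplacian matrix. The quotient matrix $Q_L$ is the $k\times k$ matrix with $(Q_L)_{ij}=\sum_{v\in\pi_j}L_{uv}$ for any $u\in\pi_i$ (this is independent of the choice of $u$). -}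

module Defs where

open import Algebra.Properties.Monoid.Sum using (sum)
open import Data.Bool using (Bool; false; not; _∧_; if_then_else_)
open import Data.Fin using (Fin; zero; suc; toℕ; fromℕ; inject₁; punchIn; splitAt; _≟_)
open import Data.Integer using (ℤ; +_; 0ℤ; 1ℤ; -1ℤ; _+_; _-_; _*_; _^_; _≤_)
open import Data.Integer.Properties using (+-0-monoid; *-1-monoid)
open import Data.Nat using (ℕ; zero; suc; _∸_)
import Data.Nat as ℕ
open import Data.Nat.DivMod using (_/_)
open import Data.Product using (Σ; ∃; _×_; _,_)
open import Data.Sum using (_⊎_; inj₁; inj₂; [_,_]′)
open import Relation.Binary.PropositionalEquality using (_≡_; _≢_; refl; sym; cong; cong₂)
open import Relation.Nullary using (does; yes; no; contradiction)

∑ : ∀ {n} → (Fin n → ℤ) → ℤ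
∑ = sum +-0-monoid

∏ : ∀ {n} → (Fin n → ℤ) → ℤ
∏ = sum *-1-monoid

∑₁ : ℕ → (ℕ → ℤ) → ℤ
∑₁ n f = ∑ {n} λ i → f (suc (toℕ i))

∏₁ : ℕ → (ℕ → ℤ) → ℤ
∏₁ n f = ∏ {n} λ i → f (suc (toℕ i))

Matrix : ℕ → Set
Matrix n = Fin n → Fin n → ℤ

diagonal : ∀ {n} → (Fin n → ℤ) → Matrix n
diagonal d i j = if does (i ≟ j) then d i else 0ℤ

det : ∀ {n} → Matrix n → ℤ
det {zero}  M = 1ℤ
det {suc n} M = ∑ λ j →
  -1ℤ ^ toℕ j * M zero j * det (λ r c → M (suc r) (punchIn j c))

-- The characteristic polynomial det (xI - M), as a polynomial function.
-- Since ℤ is an infinite integral domain, an identity between polynomial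
-- functions on ℤ is the same as an identity between polynomials.
charPoly : ∀ {n} → Matrix n → ℤ → ℤ
charPoly M x = det λ i j → diagonal (λ _ → x) i j - M i j

-- μ 1 ≤ ⋯ ≤ μ n are the eigenvalues of M, listed with multiplicity, i.e.
-- the characteristic polynomial splits as (x - μ 1) ⋯ (x - μ n).
-- Only the values of μ at 1, …, n matter.
record EigenvaluesListedAs {n} (M : Matrix n) (μ : ℕ → ℤ) : Set where
  field
    sorted : ∀ i → 1 ℕ.≤ i → i ℕ.< n → μ i ≤ μ (suc i)
    splits : ∀ x → charPoly M x ≡ ∏₁ n λ i → x - μ i

-- An integer μ with a real or rational eigenvector for an integer matrix
-- also has an integer one, so integer eigenvectors suffice.
IsEigenvalue : ∀ {n} → Matrix n → ℤ → Set
IsEigenvalue {n} M μ = Σ (Fin n → ℤ) λ v →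
  (∃ λ i → v i ≢ 0ℤ) × (∀ i → ∑ (λ j → M i j * v j) ≡ μ * v i)

-- Q is the quotient matrix of M for the partition of the indices into the
-- fibres of π.  When π is surjective, Q is unique if it exists.
IsQuotientMatrix : ∀ {n k} → Matrix n → (Fin n → Fin k) → Matrix k → Set
IsQuotientMatrix M π Q = ∀ u j →
  Q (π u) j ≡ ∑ λ v → if does (π v ≟ j) then M u v else 0ℤ

record Graph : Set where
  field
    order      : ℕ
    adj        : Fin order → Fin order → Bool
    adj-sym    : ∀ u v → adj u v ≡ adj v u
    adj-irrefl : ∀ u → adj u u ≡ false

open Graph public

distinct : ∀ {n} → Fin n → Fin n → Bool
distinct u v = not (does (u ≟ v))

distinct-sym : ∀ {n} (u v : Fin n) → distinct u v ≡ distinct v u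
distinct-sym u v with u ≟ v | v ≟ u
... | yes _   | yes _   = refl
... | no  _   | no  _   = refl
... | yes u≡v | no  v≢u = contradiction (sym u≡v) v≢u
... | no  u≢v | yes v≡u = contradiction (sym v≡u) u≢v

distinct-irrefl : ∀ {n} (u : Fin n) → distinct u u ≡ false
distinct-irrefl u with u ≟ u
... | yes _   = refl
... | no  u≢u = contradiction refl u≢u

K : ℕ → Graph
K n = record
  { order      = n
  ; adj        = distinct
  ; adj-sym    = distinct-sym
  ; adj-irrefl = distinct-irrefl
  }

complement : Graph → Graph
complement G = record
  { order      = order G
  ; adj        = λ u v → distinct u v ∧ not (adj G u v)
  ; adj-sym    = λ u v → cong₂ (λ d a → d ∧ not a) (distinct-sym u v) (adj-sym G u v)
  ; adj-irrefl = λ u → cong (_∧ not (adj G u u)) (distinct-irrefl u)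
  }

module _ (G H : Graph) where

  adj⊎ : (x y : Fin (order G) ⊎ Fin (order H)) → Bool
  adj⊎ (inj₁ u) (inj₁ v) = adj G u v
  adj⊎ (inj₂ u) (inj₂ v) = adj H u v
  adj⊎ (inj₁ _) (inj₂ _) = false
  adj⊎ (inj₂ _) (inj₁ _) = false

  adj⊎-sym : ∀ x y → adj⊎ x y ≡ adj⊎ y x
  adj⊎-sym (inj₁ u) (inj₁ v) = adj-sym G u v
  adj⊎-sym (inj₂ u) (inj₂ v) = adj-sym H u v
  adj⊎-sym (inj₁ _) (inj₂ _) = refl
  adj⊎-sym (inj₂ _) (inj₁ _) = refl

  adj⊎-irrefl : ∀ x → adj⊎ x x ≡ false
  adj⊎-irrefl (inj₁ u) = adj-irrefl G u
  adj⊎-irrefl (inj₂ u) = adj-irrefl H u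

  _∪_ : Graph
  _∪_ = record
    { order      = order G ℕ.+ order H
    ; adj        = λ u v → adj⊎ (splitAt (order G) u) (splitAt (order G) v)
    ; adj-sym    = λ u v → adj⊎-sym (splitAt (order G) u) (splitAt (order G) v)
    ; adj-irrefl = λ u → adj⊎-irrefl (splitAt (order G) u)
    }

adjacency : (G : Graph) → Matrix (order G)
adjacency G u v = if adj G u v then 1ℤ else 0ℤ

degree : (G : Graph) → Fin (order G) → ℤ
degree G u = ∑ (adjacency G u)

laplacian : (G : Graph) → Matrix (order G)
laplacian G u v = diagonal (degree G) u v - adjacency G u v

-- C α k is C(α 1, …, α k): indices start at 1, and values of α outside
-- 1, …, k are irrelevant.  The value at k = 0 is a dummy.
C : (ℕ → ℕ) → ℕ → Graph
C α zero          = K 0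
C α (suc zero)    = complement (K (α 1))
C α (suc (suc k)) = complement (C α (suc k) ∪ K (α (suc (suc k))))

-- The set πᵢ of vertices introduced at step i is the fibre of part over the
-- element of Fin k whose toℕ is i - 1.
part : ∀ α k → Fin (order (C α k)) → Fin k
part α (suc zero)    u = zero
part α (suc (suc k)) u =
  [ (λ v → inject₁ (part α (suc k) v)) , (λ _ → fromℕ (suc k)) ]′
  (splitAt (order (C α (suc k))) u)

-- In the stated ranges of i every truncated subtraction is exact.
record Recurrence (α : ℕ → ℕ) (k : ℕ) (μ : ℕ → ℤ) : Set where
  field
    first : μ 1 ≡ 0ℤ
    last  : μ k ≡ ∑₁ k (λ i → + α i)
    lower : ∀ i → 2 ℕ.≤ i → i ℕ.≤ k / 2 →
            μ i ≡ μ (i ∸ 1) + + α (k ∸ 2 ℕ.* (i ∸ 2))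
    upper : ∀ i → k / 2 ℕ.+ 1 ℕ.≤ i → i ℕ.≤ k ∸ 1 →
            μ i ≡ μ (i ℕ.+ 1) - + α (2 ℕ.* i ∸ (k ∸ 1))

record ExplicitForm (α : ℕ → ℕ) (k : ℕ) (μ : ℕ → ℤ) : Set where
  field
    -- α k + α (k - 2) + ⋯ + α (k - 2i + 4)
    lower : ∀ i → 2 ℕ.≤ i → i ℕ.≤ k / 2 →
            μ i ≡ ∑₁ (i ∸ 1) λ l → + α (k ∸ 2 ℕ.* (l ∸ 1))
    upper : ∀ i → 1 ℕ.≤ i → i ℕ.≤ k / 2 →
            μ (k / 2 ℕ.+ i) ≡
              ∑₁ (k / 2) (λ l → + α (2 ℕ.* l)) + ∑₁ i (λ m → + α (2 ℕ.* m ∸ 1))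

{-# OPTIONS --safe #-}
module Submission where

-- The quotient matrix is the Laplacian of a weighted graph on the parts in
-- which the entry (i , j), i ≠ j, is -αⱼ or 0 depending only on max(i , j).
-- Hence the first two rows of xI - Q_L agree from the third column on, and
-- their difference is (y, -y, 0, …, 0) with y = x - ρ for an explicit ρ.
-- Expanding along this difference takes out the factor y and adds up the
-- first two columns, which leaves the matrix of the same shape in which the
-- first two parts are merged.  So the characteristic polynomial splits with
-- roots ρ, alternately from the upper and the lower half of the claimed
-- list, and eigenvectors lift along the merging.  Sorted lists of roots are
-- unique, and so are solutions of the recurrence.

open import Algebra.Bundles using (CommutativeMonoid; Semiring)
import Algebra.Properties.CommutativeMonoid.Sum as MonoidSum
import Algebra.Properties.Semiring.Sum as SemiringSum
open import Data.Bool using (Bool; true; false; not; _∧_; if_then_else_)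
open import Data.Fin using (Fin; zero; suc; toℕ; fromℕ; fromℕ<; inject₁; punchIn; splitAt; _↑ˡ_; _↑ʳ_; _≟_)
open import Data.Fin.Properties using (toℕ-inject₁; toℕ-fromℕ; toℕ-fromℕ<; toℕ<n; toℕ≤pred[n]; splitAt-↑ˡ; splitAt-↑ʳ)
open import Data.Fin.Relation.Unary.Top using (view; ‵fromℕ; ‵inject₁)
open import Data.Integer using (ℤ; +_; 0ℤ; 1ℤ; -1ℤ; _+_; _-_; _*_; -_; _^_; ∣_∣; ≢-nonZero)
import Data.Integer as ℤ
open import Data.Integer.Divisibility.Signed using (∣⇒∣ᵤ; ∣m∣n⇒∣m+n; ∣m∣n⇒∣m-n; ∣m⇒∣m*n; ∣n⇒∣m*n; ∣-refl) renaming (_∣_ to _∣ℤ_; divides to dividesℤ)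
open import Data.Integer.Properties using (+-*-semiring; *-1-commutativeMonoid; -1*i≡-i; *-zeroʳ; *-comm; suc-*; +-identityˡ; +-identityʳ; +-inverseʳ; +-injective; *-cancelˡ-≡; i*j≡0⇒i≡0∨j≡0; i-j≡0⇒i≡j; i≤i+j; ∣i∣≡0⇒i≡0)
import Data.Integer.Properties as ℤₚ
open import Data.Integer.Tactic.RingSolver using (solve-∀)
open import Data.Nat using (ℕ; zero; suc; z≤n; s≤s; _≤_; _<_; _≤?_; _∸_; _⊔_)
import Data.Nat as ℕ
open import Data.Nat.Divisibility using (_∣_; divides; >⇒∤)
open import Data.Nat.DivMod using (_/_; m*n/n≡m; m/n≤m)
import Data.Nat.Properties as ℕₚ
open import Data.Nat.Tactic.RingSolver using () renaming (solve-∀ to ℕ-solve-∀)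
open import Data.Product using (∃; _×_; _,_; proj₁; proj₂)
open import Data.Sum using (_⊎_; inj₁; inj₂; [_,_]′)
open import Function using (_∘_)
open import Function.Bundles using (_⇔_; mk⇔)
open import Relation.Binary.PropositionalEquality using (_≡_; _≢_; refl; sym; trans; cong; cong₂; subst; subst₂; module ≡-Reasoning)
open import Relation.Nullary using (does; yes; no; contradiction)
open import Relation.Nullary.Decidable using (dec-true; dec-false)
open import Defs

-- Finite sums and products

-- Any commutative monoid is allowed, so that the same reindexings serve `∑` in the closed forms of
-- the roots and `∏` in sorting the linear factors.
module IndexedSum {c ℓ} (M : CommutativeMonoid c ℓ) where

  private module M = CommutativeMonoid M
  open M using (_∙_; _≈_) renaming (Carrier to A)
  open MonoidSum M using (sum; sum-cong-≗; sum-init-last)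

  sum-↑ : ∀ m {n} (f : Fin (m ℕ.+ n) → A) → sum f ≈ sum (f ∘ (_↑ˡ n)) ∙ sum (f ∘ (m ↑ʳ_))
  sum-↑ zero    f = M.sym (M.identityˡ _)
  sum-↑ (suc m) f = M.trans (M.∙-congˡ (sum-↑ m (f ∘ suc))) (M.sym (M.assoc _ _ _))

  sum-+ : ∀ m {n} (f : ℕ → A) →
          sum {m ℕ.+ n} (f ∘ toℕ) ≈ sum {m} (f ∘ toℕ) ∙ sum {n} (λ i → f (m ℕ.+ toℕ i))
  sum-+ zero    f = M.sym (M.identityˡ _)
  sum-+ (suc m) f = M.trans (M.∙-congˡ (sum-+ m (f ∘ suc))) (M.sym (M.assoc _ _ _))

  sum-snoc : ∀ n (f : ℕ → A) → sum {suc n} (f ∘ toℕ) ≈ sum {n} (f ∘ toℕ) ∙ f n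
  sum-snoc n f = M.trans (sum-init-last (f ∘ toℕ))
    (M.reflexive (cong₂ _∙_ (sum-cong-≗ {n} λ i → cong f (toℕ-inject₁ i)) (cong f (toℕ-fromℕ n))))

  sum-reverse : ∀ n (f : ℕ → A) → sum {n} (f ∘ toℕ) ≈ sum {n} (λ i → f (n ∸ suc (toℕ i)))
  sum-reverse zero    f = M.refl
  sum-reverse (suc n) f =
    M.trans (sum-snoc n f) (M.trans (M.comm _ _) (M.∙-congˡ (sum-reverse n f)))

  -- Merging produces upper and lower eigenvalues in turn; separating positions by parity pulls the
  -- two halves apart.
  sum-interleave : ∀ n (f : ℕ → A) →
    sum {n ℕ.* 2} (f ∘ toℕ) ≈
    sum {n} (λ i → f (toℕ i ℕ.* 2)) ∙ sum {n} (λ i → f (suc (toℕ i ℕ.* 2)))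
  sum-interleave zero    f = M.sym (M.identityˡ _)
  sum-interleave (suc n) f =
    M.trans (M.∙-congˡ (M.∙-congˡ (sum-interleave n λ i → f (suc (suc i)))))
      (M.trans (M.∙-congˡ (x∙yz≈y∙xz _ _ _)) (M.sym (M.assoc _ _ _)))
    where open import Algebra.Properties.CommutativeSemigroup M.commutativeSemigroup using (x∙yz≈y∙xz)

open SemiringSum +-*-semiring using (sum-replicate-zero; ∑-distrib-+; ∑-comm; *-distribˡ-sum; *-distribʳ-sum)
  renaming (sum-cong-≗ to ∑-cong)
open MonoidSum *-1-commutativeMonoid using () renaming (sum-cong-≗ to ∏-cong)
module Sum = IndexedSum (Semiring.+-commutativeMonoid +-*-semiring)
module Prod = IndexedSum *-1-commutativeMonoid

∑-zero : ∀ {n} {f : Fin n → ℤ} → (∀ i → f i ≡ 0ℤ) → ∑ f ≡ 0ℤ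
∑-zero {n} f≡0 = trans (∑-cong f≡0) (sum-replicate-zero n)

∑-neg : ∀ {n} (f : Fin n → ℤ) → ∑ (λ i → - f i) ≡ - ∑ f
∑-neg f = trans (∑-cong λ i → sym (-1*i≡-i (f i)))
  (trans (sym (*-distribˡ-sum -1ℤ f)) (-1*i≡-i (∑ f)))

∑-distrib-- : ∀ {n} (f g : Fin n → ℤ) → ∑ (λ i → f i - g i) ≡ ∑ f - ∑ g
∑-distrib-- f g = trans (∑-distrib-+ f (-_ ∘ g)) (cong (_+_ (∑ f)) (∑-neg g))

∑-indicator : ∀ {n} (i : Fin n) (f : Fin n → ℤ) →
              ∑ (λ j → if does (i ≟ j) then f j else 0ℤ) ≡ f i
∑-indicator {suc n} zero f = trans (cong (_+_ (f zero)) (sum-replicate-zero n)) (+-identityʳ _)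
∑-indicator (suc i) f = trans (+-identityˡ _) (∑-indicator i (f ∘ suc))

∑-const : ∀ n x → ∑ {n} (λ _ → x) ≡ + n * x
∑-const zero    x = refl
∑-const (suc n) x = trans (cong (_+_ x) (∑-const n x)) (sym (suc-* (+ n) x))

∑-indicatorʳ : ∀ {n} (j : Fin n) (f : Fin n → ℤ) →
               ∑ (λ i → if does (i ≟ j) then f i else 0ℤ) ≡ f j
∑-indicatorʳ {suc n} zero    f = trans (cong (_+_ (f zero)) (sum-replicate-zero n)) (+-identityʳ _)
∑-indicatorʳ {suc n} (suc j) f = trans (+-identityˡ _) (∑-indicatorʳ j (f ∘ suc))

-- Determinants

det-cong : ∀ {n} {M N : Matrix n} → (∀ i j → M i j ≡ N i j) → det M ≡ det N
det-cong {zero}  M≡N = refl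
det-cong {suc n} M≡N = ∑-cong λ j →
  cong₂ (λ a d → -1ℤ ^ toℕ j * a * d) (M≡N zero j) (det-cong λ r c → M≡N (suc r) (punchIn j c))

private
  regroup : ∀ m s a t b d → m * s * a * (t * b * d) ≡ m * t * b * (s * a * d)
  regroup = solve-∀

  -- Swaps the order of a double Laplace expansion: `D i j` stands for a second minor and `x` for
  -- the sign common to both orders.
  exchange : ∀ {m n} x (s a : Fin m → ℤ) (t b : Fin n → ℤ) (D : Fin n → Fin m → ℤ) →
    ∑ (λ j → x * s j * a j * ∑ λ i → t i * b i * D i j) ≡
    ∑ (λ i → x * t i * b i * ∑ λ j → s j * a j * D i j)
  exchange {m} {n} x s a t b D = begin
    ∑ (λ j → x * s j * a j * ∑ λ i → t i * b i * D i j)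
      ≡⟨ ∑-cong {m} (λ j → *-distribˡ-sum {n} (x * s j * a j) (λ i → t i * b i * D i j)) ⟩
    ∑ (λ j → ∑ λ i → x * s j * a j * (t i * b i * D i j))
      ≡⟨ ∑-comm {m} {n} (λ j i → x * s j * a j * (t i * b i * D i j)) ⟩
    ∑ (λ i → ∑ λ j → x * s j * a j * (t i * b i * D i j))
      ≡⟨ ∑-cong {n} (λ i → ∑-cong {m} λ j → regroup x (s j) (a j) (t i) (b i) (D i j)) ⟩
    ∑ (λ i → ∑ λ j → x * t i * b i * (s j * a j * D i j))
      ≡⟨ ∑-cong {n} (λ i → sym (*-distribˡ-sum {m} (x * t i * b i) (λ j → s j * a j * D i j))) ⟩
    ∑ (λ i → x * t i * b i * ∑ λ j → s j * a j * D i j) ∎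
    where open ≡-Reasoning

-- The corner term is the same in both expansions. In every other term of the row expansion the
-- minor is expanded along its own first column, and `exchange` regroups the double sum by rows.
det-firstColumn : ∀ {n} (M : Matrix (suc n)) →
  det M ≡ ∑ λ i → -1ℤ ^ toℕ i * M i zero * det (λ r c → M (punchIn i r) (suc c))
det-firstColumn {zero}  M = refl
det-firstColumn {suc n} M = cong (_+_ (1ℤ * M zero zero * det λ r c → M (suc r) (suc c))) (trans
  (∑-cong {suc n} λ j → cong (λ d → -1ℤ ^ suc (toℕ j) * M zero (suc j) * d)
    (det-firstColumn λ r c → M (suc r) (punchIn (suc j) c)))
  (exchange -1ℤ (λ j → -1ℤ ^ toℕ j) (λ j → M zero (suc j)) (λ i → -1ℤ ^ toℕ i) (λ i → M (suc i) zero)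
    (λ i j → det λ r c → M (suc (punchIn i r)) (suc (punchIn j c)))))

private
  cancelHead : ∀ a d → 1ℤ * a * d + (- 1ℤ * 1ℤ * a * d + 0ℤ) ≡ 0ℤ
  cancelHead = solve-∀

-- Along the first column, the top two terms have equal minors and opposite signs; every other minor
-- keeps two equal rows on top and vanishes by induction.
det-equalRows : ∀ {n} (M : Matrix (suc (suc n))) →
  (∀ c → M zero c ≡ M (suc zero) c) → det M ≡ 0ℤ
det-equalRows {n} M M₀≡M₁ = trans (det-firstColumn M)
  (trans (cong₂ (λ s t → 1ℤ * M zero zero * d + (s + t)) second (rest M M₀≡M₁))
    (cancelHead (M zero zero) d))
  where
  d = det λ r c → M (suc r) (suc c)
  second : -1ℤ ^ 1 * M (suc zero) zero * det (λ r c → M (punchIn (suc zero) r) (suc c)) ≡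
           - 1ℤ * 1ℤ * M zero zero * d
  second = cong₂ (λ a e → -1ℤ ^ 1 * a * e) (sym (M₀≡M₁ zero))
    (det-cong {M = λ r c → M (punchIn (suc zero) r) (suc c)} {λ r c → M (suc r) (suc c)}
      λ { zero c → M₀≡M₁ (suc c) ; (suc r) c → refl })
  rest : ∀ {n} (M : Matrix (suc (suc n))) → (∀ c → M zero c ≡ M (suc zero) c) →
    ∑ {n} (λ i → -1ℤ ^ toℕ (suc (suc i)) * M (suc (suc i)) zero *
      det (λ r c → M (punchIn (suc (suc i)) r) (suc c))) ≡ 0ℤ
  rest {zero}  M eq = refl
  rest {suc n} M eq = ∑-zero λ i →
    trans (cong (-1ℤ ^ toℕ (suc (suc i)) * M (suc (suc i)) zero *_)
      (det-equalRows (λ r c → M (punchIn (suc (suc i)) r) (suc c)) (eq ∘ suc)))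
      (*-zeroʳ (-1ℤ ^ toℕ (suc (suc i)) * M (suc (suc i)) zero))

private
  splitTerm : ∀ s a b d → s * (a + b) * d ≡ s * a * d + s * b * d
  splitTerm = solve-∀

det-addFirstColumns : ∀ {n} (A B C : Matrix (suc n)) →
  (∀ r → A r zero ≡ B r zero + C r zero) →
  (∀ r c → A r (suc c) ≡ B r (suc c)) → (∀ r c → A r (suc c) ≡ C r (suc c)) →
  det A ≡ det B + det C
det-addFirstColumns A B C A≡B+C A≡B A≡C = begin
  det A
    ≡⟨ det-firstColumn A ⟩
  ∑ (λ i → s i * A i zero * det (λ r c → A (punchIn i r) (suc c)))
    ≡⟨ ∑-cong (λ i → trans (cong (λ a → s i * a * _) (A≡B+C i)) (trans
         (splitTerm (s i) (B i zero) (C i zero) _)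
         (cong₂ (λ d e → s i * B i zero * d + s i * C i zero * e)
           (det-cong λ r c → A≡B (punchIn i r) c) (det-cong λ r c → A≡C (punchIn i r) c)))) ⟩
  ∑ (λ i → s i * B i zero * det (λ r c → B (punchIn i r) (suc c)) +
           s i * C i zero * det (λ r c → C (punchIn i r) (suc c)))
    ≡⟨ ∑-distrib-+ (λ i → s i * B i zero * det (λ r c → B (punchIn i r) (suc c)))
                   (λ i → s i * C i zero * det (λ r c → C (punchIn i r) (suc c))) ⟩
  _ ≡⟨ sym (cong₂ _+_ (det-firstColumn B) (det-firstColumn C)) ⟩
  det B + det C ∎
  where
  open ≡-Reasoning
  s : Fin _ → ℤ
  s i = -1ℤ ^ toℕ i

charPoly-cong : ∀ {n} {M N : Matrix n} → (∀ i j → M i j ≡ N i j) → ∀ x → charPoly M x ≡ charPoly N x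
charPoly-cong M≡N x = det-cong λ i j → cong (_-_ (diagonal (λ _ → x) i j)) (M≡N i j)

mergeColumns : ∀ {n} → Matrix (suc (suc n)) → Matrix (suc n)
mergeColumns M r zero    = M (suc r) zero + M (suc r) (suc zero)
mergeColumns M r (suc c) = M (suc r) (suc (suc c))

private
  twinTerms : ∀ a b y d e t →
    1ℤ * (a + y) * d + (- 1ℤ * 1ℤ * (b - y) * e + t) ≡
    (1ℤ * a * d + (- 1ℤ * 1ℤ * b * e + t)) + y * (e + d)
  twinTerms = solve-∀

-- Subtracting row 1 from row 0 leaves (y, -y, 0, …, 0).
det-twinRows : ∀ {n} (M : Matrix (suc (suc n))) y →
  M zero zero ≡ M (suc zero) zero + y →
  M zero (suc zero) ≡ M (suc zero) (suc zero) - y →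
  (∀ c → M zero (suc (suc c)) ≡ M (suc zero) (suc (suc c))) →
  det M ≡ y * det (mergeColumns M)
det-twinRows {n} M y eq₀ eq₁ eq = begin
  det M
    ≡⟨ cong₂ (λ a r → 1ℤ * a * d₀ + r) eq₀
         (cong₂ (λ b t → - 1ℤ * 1ℤ * b * d₁ + t) eq₁
           (∑-cong {n} λ c → cong (λ a → -1ℤ ^ toℕ (suc (suc c)) * a *
             det (λ r c′ → M (suc r) (punchIn (suc (suc c)) c′))) (eq c))) ⟩
  _ ≡⟨ twinTerms (M (suc zero) zero) (M (suc zero) (suc zero)) y d₀ d₁ _ ⟩
  det N + y * (d₁ + d₀)
    -- `N` repeats row 1 and so contributes nothing. The minors `d₀` and `d₁` differ only in their
    -- first column, and the signs make them add.
    ≡⟨ cong₂ (λ a b → a + y * b) (det-equalRows N λ _ → refl)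
         (sym (det-addFirstColumns (mergeColumns M)
           (λ r c → M (suc r) (punchIn (suc zero) c)) (λ r c → M (suc r) (suc c))
           (λ _ → refl) (λ _ _ → refl) (λ _ _ → refl))) ⟩
  0ℤ + y * det (mergeColumns M)
    ≡⟨ +-identityˡ _ ⟩
  y * det (mergeColumns M) ∎
  where
  open ≡-Reasoning
  N : Matrix (suc (suc n))
  N zero    c = M (suc zero) c
  N (suc r) c = M (suc r) c
  d₀ = det λ r c → M (suc r) (suc c)
  d₁ = det λ r c → M (suc r) (punchIn (suc zero) c)

-- Weighted Laplacians

-- Parts are indexed from 0; b gives their sizes and e (max i j) tells
-- whether parts i and j are joined.
weight : (b e : ℕ → ℤ) → ∀ {n} → Matrix n
weight b e i j = if does (i ≟ j) then 0ℤ else e (toℕ i ⊔ toℕ j) * b (toℕ j)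

weightedLaplacian : (b e : ℕ → ℤ) → ∀ {n} → Matrix n
weightedLaplacian b e i j = diagonal (λ i → ∑ (weight b e i)) i j - weight b e i j

-- Parts 0 and 1 become part 0 and later indices drop by one. The larger index of each surviving
-- pair drops along, so `merge b` goes with `e ∘ suc`.
merge : (ℕ → ℤ) → ℕ → ℤ
merge b zero    = b 0 + b 1
merge b (suc i) = b (suc (suc i))

-- The n + 1 roots for n + 1 parts, in the order in which merging produces
-- them; values beyond index n are junk.
root : ℕ → (b e : ℕ → ℤ) → ℕ → ℤ
root zero    b e i       = 0ℤ
root (suc n) b e zero    = e 1 * (b 0 + b 1) + ∑ {n} λ l → e (2 ℕ.+ toℕ l) * b (2 ℕ.+ toℕ l)
root (suc n) b e (suc i) = root n (merge b) (e ∘ suc) i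

private
  corner₀ : ∀ x a b e t → x - (0ℤ + (e * b + t) - 0ℤ) ≡ 0ℤ - (0ℤ - e * a) + (x - (e * (a + b) + t))
  corner₀ = solve-∀

  corner₁ : ∀ x a b e t → 0ℤ - (0ℤ - e * b) ≡ x - (e * a + (0ℤ + t) - 0ℤ) - (x - (e * (a + b) + t))
  corner₁ = solve-∀

  mergeCorner : ∀ x a e t → 0ℤ - (0ℤ - e * a) + (x - (e * a + (0ℤ + t) - 0ℤ)) ≡ x - (0ℤ + t - 0ℤ)
  mergeCorner = solve-∀

  mergeColumn : ∀ a b e → 0ℤ - (0ℤ - e * a) + (0ℤ - (0ℤ - e * b)) ≡ 0ℤ - (0ℤ - e * (a + b))
  mergeColumn = solve-∀

  mergeWeights : ∀ a b e t → e * a + (e * b + t) ≡ e * (a + b) + t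
  mergeWeights = solve-∀

charPoly-weightedLaplacian : ∀ n b e x →
  charPoly (weightedLaplacian b e {suc n}) x ≡ ∏ {suc n} λ i → x - root n b e (toℕ i)
charPoly-weightedLaplacian zero    b e x = trans (+-identityʳ _) (size₁ x)
  where
  size₁ : ∀ x → 1ℤ * (x - (0ℤ - 0ℤ)) * 1ℤ ≡ (x - 0ℤ) * 1ℤ
  size₁ = solve-∀
charPoly-weightedLaplacian (suc n) b e x = trans
  (det-twinRows M (x - root (suc n) b e 0)
    (corner₀ x (b 0) (b 1) (e 1) T) (corner₁ x (b 0) (b 1) (e 1) T) λ _ → refl)
  (cong (λ d → (x - root (suc n) b e 0) * d)
    (trans (det-cong merged) (charPoly-weightedLaplacian n (merge b) (e ∘ suc) x)))
  where
  M : Matrix (suc (suc n))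
  M i j = diagonal (λ _ → x) i j - weightedLaplacian b e i j
  T = ∑ {n} λ l → e (2 ℕ.+ toℕ l) * b (2 ℕ.+ toℕ l)
  merged : ∀ i j → mergeColumns M i j ≡ diagonal (λ _ → x) i j - weightedLaplacian (merge b) (e ∘ suc) i j
  -- Row 1 serves as the row of the merged part: adding its first two entries cancels `e 1 * b 0`,
  -- the weight between the two parts that become one.
  merged zero    zero    = mergeCorner x (b 0) (e 1) T
  merged zero    (suc j) = refl
  merged (suc i) zero    = mergeColumn (b 0) (b 1) (e (2 ℕ.+ toℕ i))
  merged (suc i) (suc j) =
    cong (λ d → diagonal (λ _ → x) i j - ((if does (i ≟ j) then d else 0ℤ) - weight (merge b) (e ∘ suc) (suc i) (suc j)))
      (mergeWeights (b 0) (b 1) (e (2 ℕ.+ toℕ i)) _)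

-- Eigenvectors of weighted Laplacians

-- The diagonal holds the row sums of the weights, so only differences of entries of `v` matter. In
-- this form two parts with equal entries contribute nothing to each other, which makes lifting
-- along a merge easy.
weightedLaplacian-apply : ∀ b e {n} (v : Fin n → ℤ) i →
  ∑ (λ j → weightedLaplacian b e i j * v j) ≡ ∑ λ j → weight b e i j * (v i - v j)
weightedLaplacian-apply b e {n} v i = begin
  ∑ (λ j → (diagonal d i j - W j) * v j)
    ≡⟨ ∑-cong {n} (λ j → trans (distrib (diagonal d i j) (W j) (v j)) (cong (λ z → z - W j * v j) (select j))) ⟩
  ∑ (λ j → (if does (i ≟ j) then d i * v j else 0ℤ) - W j * v j)
    ≡⟨ ∑-distrib-- {n} (λ j → if does (i ≟ j) then d i * v j else 0ℤ) (λ j → W j * v j) ⟩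
  ∑ (λ j → if does (i ≟ j) then d i * v j else 0ℤ) - ∑ (λ j → W j * v j)
    ≡⟨ cong (λ z → z - ∑ (λ j → W j * v j)) (trans (∑-indicator i (λ j → d i * v j)) (*-distribʳ-sum {n} (v i) W)) ⟩
  ∑ (λ j → W j * v i) - ∑ (λ j → W j * v j)
    ≡⟨ sym (∑-distrib-- {n} (λ j → W j * v i) (λ j → W j * v j)) ⟩
  ∑ (λ j → W j * v i - W j * v j)
    ≡⟨ ∑-cong {n} (λ j → sym (factor (W j) (v i) (v j))) ⟩
  ∑ (λ j → W j * (v i - v j)) ∎
  where
  open ≡-Reasoning
  W : Fin n → ℤ
  W = weight b e i
  d : Fin n → ℤ
  d i = ∑ (weight b e i)
  distrib : ∀ a w z → (a - w) * z ≡ a * z - w * z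
  distrib = solve-∀
  factor : ∀ w y z → w * (y - z) ≡ w * y - w * z
  factor = solve-∀
  select : ∀ j → diagonal d i j * v j ≡ (if does (i ≟ j) then d i * v j else 0ℤ)
  select j with does (i ≟ j)
  ... | true  = refl
  ... | false = refl

private
  headEntry : ∀ b₀ b₁ e t →
    0ℤ * (b₁ - b₁) + (e * b₁ * (b₁ - (- b₀)) + t * b₁) ≡ (e * (b₀ + b₁) + t) * b₁
  headEntry = solve-∀

  secondEntry : ∀ b₀ b₁ e t →
    e * b₀ * (- b₀ - b₁) + (0ℤ * (- b₀ - (- b₀)) + t * (- b₀)) ≡ (e * (b₀ + b₁) + t) * (- b₀)
  secondEntry = solve-∀

  laterEntry : ∀ b₀ b₁ e r → e * b₀ * (0ℤ - b₁) + (e * b₁ * (0ℤ - (- b₀)) + 0ℤ) ≡ r * 0ℤ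
  laterEntry = solve-∀

  liftHead : ∀ w b₁ e t → 0ℤ * (w - w) + (e * b₁ * (w - w) + t) ≡ 0ℤ * (w - w) + t
  liftHead = solve-∀

  liftSecond : ∀ w b₀ e t → e * b₀ * (w - w) + (0ℤ * (w - w) + t) ≡ 0ℤ * (w - w) + t
  liftSecond = solve-∀

  liftLater : ∀ b₀ b₁ e w t → e * b₀ * w + (e * b₁ * w + t) ≡ e * (b₀ + b₁) * w + t
  liftLater = solve-∀

-- The eigenvector (b₁, -b₀, 0, …, 0) belongs to the first root; those of
-- the merged matrix lift by repeating their first entry.
weightedEigenvector : ∀ n b e → (∀ i → i < n → b (suc i) ≢ 0ℤ) → ∀ m → m ≤ n →
  ∃ λ (v : Fin (suc n) → ℤ) → (∃ λ i → v i ≢ 0ℤ) ×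
    ∀ i → ∑ (λ j → weight b e i j * (v i - v j)) ≡ root n b e m * v i
weightedEigenvector zero b e b≢0 m m≤n =
  (λ _ → 1ℤ) , (zero , λ ()) , λ { zero → refl }
weightedEigenvector (suc n) b e b≢0 zero m≤n = v , (zero , b≢0 0 (s≤s z≤n)) , eigen
  where
  v : Fin (suc (suc n)) → ℤ
  v zero          = b 1
  v (suc zero)    = - b 0
  v (suc (suc i)) = 0ℤ
  t : Fin n → ℤ
  t l = e (2 ℕ.+ toℕ l) * b (2 ℕ.+ toℕ l)
  tail : ∀ y → ∑ (λ l → t l * (y - 0ℤ)) ≡ ∑ t * y
  tail y = trans (∑-cong {n} λ l → cong (t l *_) (+-identityʳ y)) (sym (*-distribʳ-sum {n} y t))
  eigen : ∀ i → ∑ (λ j → weight b e i j * (v i - v j)) ≡ root (suc n) b e 0 * v i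
  eigen zero = trans
    (cong (λ s → 0ℤ * (b 1 - b 1) + (e 1 * b 1 * (b 1 - (- b 0)) + s)) (tail (b 1)))
    (headEntry (b 0) (b 1) (e 1) (∑ t))
  eigen (suc zero) = trans
    (cong (λ s → e 1 * b 0 * (- b 0 - b 1) + (0ℤ * (- b 0 - (- b 0)) + s)) (tail (- b 0)))
    (secondEntry (b 0) (b 1) (e 1) (∑ t))
  -- A later part is joined to parts 0 and 1 with the same factor `c`, so the contributions of the
  -- entries `b 1` and `- b 0` cancel.
  eigen (suc (suc i)) = trans
    (cong (λ s → c * b 0 * (0ℤ - b 1) + (c * b 1 * (0ℤ - (- b 0)) + s))
      (∑-zero {n} λ l → *-zeroʳ (weight b e {suc (suc n)} (suc (suc i)) (suc (suc l)))))
    (laterEntry (b 0) (b 1) c (root (suc n) b e 0))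
    where c = e (2 ℕ.+ toℕ i)
weightedEigenvector (suc n) b e b≢0 (suc m) (s≤s m≤n)
  -- The hypothesis on sizes speaks of parts from 1 on, so it passes to `merge b` without any claim
  -- about `b 0 + b 1`.
  with weightedEigenvector n (merge b) (e ∘ suc) (λ i i<n → b≢0 (suc i) (s≤s i<n)) m m≤n
... | v , (i₀ , vi₀≢0) , eigen = v′ , (suc i₀ , vi₀≢0) , eigen′
  where
  v′ : Fin (suc (suc n)) → ℤ
  v′ zero    = v zero
  v′ (suc i) = v i
  T = ∑ {n} λ l → e (2 ℕ.+ toℕ l) * b (2 ℕ.+ toℕ l) * (v zero - v (suc l))
  eigen′ : ∀ i → ∑ (λ j → weight b e i j * (v′ i - v′ j)) ≡ root n (merge b) (e ∘ suc) m * v′ i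
  eigen′ zero          = trans (liftHead (v zero) (b 1) (e 1) T) (eigen zero)
  eigen′ (suc zero)    = trans (liftSecond (v zero) (b 0) (e 1) T) (eigen zero)
  eigen′ (suc (suc i)) = trans (liftLater (b 0) (b 1) (e (2 ℕ.+ toℕ i)) (v (suc i) - v zero) _) (eigen (suc i))

-- The quotient matrix

even : ℕ → Bool
even zero    = true
even (suc n) = not (even n)

-- A new part is joined to all earlier ones, and every later step complements.
-- Here m counts parts from 0.
joined : ℕ → ℕ → ℤ
joined k m = if even (k ∸ suc m) then 1ℤ else 0ℤ

-- Induction on `k`. The disjoint union leaves the newest part unjoined, so the complement joins it
-- to all older ones; for older pairs the complement flips adjacency while the argument of `even`
-- grows by one.
adj-parts : ∀ α k u v → part α k u ≢ part α k v →
  adj (C α k) u v ≡ even (k ∸ suc (toℕ (part α k u) ⊔ toℕ (part α k v)))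
adj-parts α (suc zero)    u v pu≢pv = contradiction refl pu≢pv
adj-parts α (suc (suc k)) u v pu≢pv =
  trans (cong (λ d → not d ∧ not (adj⊎ G H (splitAt m u) (splitAt m v)))
          (dec-false (u ≟ v) (pu≢pv ∘ cong (part α (suc (suc k))))))
        (cross (adj-parts α (suc k)) (splitAt m u) (splitAt m v) pu≢pv)
  where
  G = C α (suc k)
  H = K (α (suc (suc k)))
  m = order G
  p : Fin (order G) ⊎ Fin (order H) → Fin (suc (suc k))
  p = [ (λ w → inject₁ (part α (suc k) w)) , (λ _ → fromℕ (suc k)) ]′
  newest : ∀ w → suc k ∸ (toℕ (inject₁ (part α (suc k) w)) ⊔ toℕ (fromℕ (suc k))) ≡ 0
  newest w rewrite toℕ-inject₁ (part α (suc k) w) | toℕ-fromℕ k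
    | ℕₚ.m≤n⇒m⊔n≡n (ℕₚ.m≤n⇒m≤1+n (toℕ≤pred[n] (part α (suc k) w))) = ℕₚ.n∸n≡0 k
  newest′ : ∀ w → suc k ∸ (toℕ (fromℕ (suc k)) ⊔ toℕ (inject₁ (part α (suc k) w))) ≡ 0
  newest′ w rewrite toℕ-inject₁ (part α (suc k) w) | toℕ-fromℕ k
    | ℕₚ.m≥n⇒m⊔n≡m (ℕₚ.m≤n⇒m≤1+n (toℕ≤pred[n] (part α (suc k) w))) = ℕₚ.n∸n≡0 k
  -- Arbitrary `x` and `y` replace the two `splitAt` results, so that matching on them reduces
  -- `adj⊎` and `p` together.
  cross : (∀ w z → part α (suc k) w ≢ part α (suc k) z →
             adj G w z ≡ even (k ∸ (toℕ (part α (suc k) w) ⊔ toℕ (part α (suc k) z)))) →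
          ∀ x y → p x ≢ p y → not (adj⊎ G H x y) ≡ even (suc k ∸ (toℕ (p x) ⊔ toℕ (p y)))
  cross rec (inj₁ w) (inj₁ z) px≢py
    rewrite toℕ-inject₁ (part α (suc k) w) | toℕ-inject₁ (part α (suc k) z)
    | ℕₚ.+-∸-assoc 1 (ℕₚ.⊔-lub (toℕ≤pred[n] (part α (suc k) w)) (toℕ≤pred[n] (part α (suc k) z)))
    = cong not (rec w z (px≢py ∘ cong inject₁))
  cross _ (inj₁ w) (inj₂ z) _     = cong even (sym (newest w))
  cross _ (inj₂ w) (inj₁ z) _     = cong even (sym (newest′ z))
  cross _ (inj₂ w) (inj₂ z) px≢py = contradiction refl px≢py

∑-part : ∀ α k (f : Fin (suc k) → ℤ) →
  ∑ (λ v → f (part α (suc k) v)) ≡ ∑ λ j → + α (suc (toℕ j)) * f j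
∑-part α zero    f = trans (∑-const (α 1) (f zero)) (sym (+-identityʳ _))
∑-part α (suc k) f = begin
  ∑ (f ∘ part α (suc (suc k)))
    ≡⟨ Sum.sum-↑ m (f ∘ part α (suc (suc k))) ⟩
  ∑ {m} (λ v → f (part α (suc (suc k)) (v ↑ˡ a))) + ∑ {a} (λ v → f (part α (suc (suc k)) (m ↑ʳ v)))
    ≡⟨ cong₂ _+_
         (∑-cong {m} λ v → cong (λ s → f ([ (λ w → inject₁ (part α (suc k) w)) , (λ _ → fromℕ (suc k)) ]′ s)) (splitAt-↑ˡ m v a))
         (∑-cong {a} λ v → cong (λ s → f ([ (λ w → inject₁ (part α (suc k) w)) , (λ _ → fromℕ (suc k)) ]′ s)) (splitAt-↑ʳ m a v)) ⟩
  ∑ {m} (λ v → f (inject₁ (part α (suc k) v))) + ∑ {a} (λ _ → f (fromℕ (suc k)))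
    ≡⟨ cong₂ _+_ (trans (∑-part α k (f ∘ inject₁))
         (∑-cong {suc k} λ j → cong (λ i → + α (suc i) * f (inject₁ j)) (sym (toℕ-inject₁ j))))
         (trans (∑-const a (f (fromℕ (suc k)))) (cong (λ i → + α (suc i) * f (fromℕ (suc k))) (sym (toℕ-fromℕ (suc k))))) ⟩
  ∑ (λ j → g (inject₁ j)) + g (fromℕ (suc k))
    ≡⟨ sym (sum-init-last g) ⟩
  ∑ g ∎
  where
  open ≡-Reasoning
  open MonoidSum (Semiring.+-commutativeMonoid +-*-semiring) using (sum-init-last)
  m = order (C α (suc k))
  a = α (suc (suc k))
  g : Fin (suc (suc k)) → ℤ
  g j = + α (suc (toℕ j)) * f j

-- Positive sizes make every part inhabited. This gives uniqueness of the quotient matrix and keeps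
-- lifted eigenvectors non-zero.
part-surjective : ∀ α k → (∀ i → 1 ≤ i → i ≤ k → 0 < α i) → ∀ j → ∃ λ u → part α k u ≡ j
part-surjective α (suc zero) α>0 zero with α 1 | α>0 1 ℕₚ.≤-refl ℕₚ.≤-refl
... | suc _ | _ = zero , refl
part-surjective α (suc (suc k)) α>0 = step
  (part-surjective α (suc k) λ l 1≤l l≤k → α>0 l 1≤l (ℕₚ.m≤n⇒m≤1+n l≤k))
  (α>0 (suc (suc k)) (s≤s z≤n) ℕₚ.≤-refl)
  where
  m = order (C α (suc k))
  -- A variable `a` replaces the newest size, so that its positivity can be used by matching on
  -- `suc a`.
  step : ∀ {a} → (∀ j → ∃ λ u → part α (suc k) u ≡ j) → 0 < a → ∀ j → ∃ λ (u : Fin (m ℕ.+ a)) →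
    [ (λ v → inject₁ (part α (suc k) v)) , (λ _ → fromℕ (suc k)) ]′ (splitAt m u) ≡ j
  step {suc a} rec _ j with view j
  ... | ‵fromℕ = m ↑ʳ zero , cong [ _ , _ ]′ (splitAt-↑ʳ m (suc a) zero)
  ... | ‵inject₁ i with rec i
  ...   | u , refl = u ↑ˡ suc a , cong [ _ , _ ]′ (splitAt-↑ˡ m u (suc a))

partSize : (ℕ → ℕ) → ℕ → ℤ
partSize α i = + α (suc i)

module _ (α : ℕ → ℕ) (k : ℕ) where

  quotient : Matrix (suc k)
  quotient = weightedLaplacian (partSize α) (joined (suc k))

  private
    G = C α (suc k)
    p = part α (suc k)

    W : Matrix (suc k)
    W = weight (partSize α) (joined (suc k))

    module _ (u : Fin (order G)) where

      -- The number of neighbours of `u` in part `j`.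
      neighbours : Fin (suc k) → ℤ
      neighbours j = ∑ λ v → if does (p v ≟ j) then adjacency G u v else 0ℤ

      -- Adjacency across parts depends on the parts alone, so all vertices of part `j` count alike
      -- and `∑-part` supplies their number.
      neighbours-other : ∀ j → p u ≢ j → neighbours j ≡ joined (suc k) (toℕ (p u) ⊔ toℕ j) * partSize α (toℕ j)
      neighbours-other j pu≢j = begin
        neighbours j
          ≡⟨ ∑-cong {order G} pointwise ⟩
        ∑ (λ v → if does (p v ≟ j) then e (p v) else 0ℤ)
          ≡⟨ ∑-part α k (λ l → if does (l ≟ j) then e l else 0ℤ) ⟩
        ∑ (λ l → partSize α (toℕ l) * (if does (l ≟ j) then e l else 0ℤ))
          ≡⟨ ∑-cong {suc k} scale ⟩
        ∑ (λ l → if does (l ≟ j) then e l * partSize α (toℕ l) else 0ℤ)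
          ≡⟨ ∑-indicatorʳ j (λ l → e l * partSize α (toℕ l)) ⟩
        e j * partSize α (toℕ j) ∎
        where
        open ≡-Reasoning
        e : Fin (suc k) → ℤ
        e l = joined (suc k) (toℕ (p u) ⊔ toℕ l)
        pointwise : ∀ v → (if does (p v ≟ j) then adjacency G u v else 0ℤ) ≡ (if does (p v ≟ j) then e (p v) else 0ℤ)
        pointwise v with p v ≟ j
        ... | yes pv≡j = cong (λ a → if a then 1ℤ else 0ℤ)
          (adj-parts α (suc k) u v λ pu≡pv → pu≢j (trans pu≡pv pv≡j))
        ... | no  _    = refl
        scale : ∀ l → partSize α (toℕ l) * (if does (l ≟ j) then e l else 0ℤ) ≡
                      (if does (l ≟ j) then e l * partSize α (toℕ l) else 0ℤ)
        scale l with does (l ≟ j)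
        ... | true  = *-comm (partSize α (toℕ l)) (e l)
        ... | false = *-zeroʳ (partSize α (toℕ l))

      neighbours-split : ∀ l → neighbours l ≡ W (p u) l + (if does (p u ≟ l) then neighbours l else 0ℤ)
      neighbours-split l with p u ≟ l
      ... | yes _    = sym (+-identityˡ _)
      ... | no  pu≢l = trans (neighbours-other l pu≢l) (sym (+-identityʳ _))

      -- The neighbours inside the own part stay uncomputed: they cancel in the diagonal entry in
      -- `row`, so cliques and independent sets are treated alike.
      degree-split : degree G u ≡ ∑ (W (p u)) + neighbours (p u)
      degree-split = begin
        ∑ (adjacency G u)
          ≡⟨ ∑-cong {order G} (λ v → sym (∑-indicator (p v) (λ _ → adjacency G u v))) ⟩
        ∑ (λ v → ∑ λ j → if does (p v ≟ j) then adjacency G u v else 0ℤ)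
          ≡⟨ ∑-comm {order G} {suc k} (λ v j → if does (p v ≟ j) then adjacency G u v else 0ℤ) ⟩
        ∑ neighbours
          ≡⟨ ∑-cong {suc k} neighbours-split ⟩
        ∑ (λ l → W (p u) l + (if does (p u ≟ l) then neighbours l else 0ℤ))
          ≡⟨ ∑-distrib-+ {suc k} (W (p u)) (λ l → if does (p u ≟ l) then neighbours l else 0ℤ) ⟩
        ∑ (W (p u)) + ∑ (λ l → if does (p u ≟ l) then neighbours l else 0ℤ)
          ≡⟨ cong (_+_ (∑ (W (p u)))) (∑-indicator (p u) neighbours) ⟩
        ∑ (W (p u)) + neighbours (p u) ∎
        where open ≡-Reasoning

      row : ∀ j → (if does (p u ≟ j) then degree G u else 0ℤ) - neighbours j ≡ quotient (p u) j
      row j with p u ≟ j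
      ... | yes refl = trans (cong (λ d → d - neighbours (p u)) degree-split)
        (cancel (∑ (W (p u))) (neighbours (p u)))
        where
        cancel : ∀ a b → a + b - b ≡ a - 0ℤ
        cancel = solve-∀
      ... | no pu≢j = cong (λ w → 0ℤ - w) (neighbours-other j pu≢j)

  quotient-isQuotientMatrix : IsQuotientMatrix (laplacian G) p quotient
  quotient-isQuotientMatrix u j = begin
    quotient (p u) j
      ≡⟨ sym (row u j) ⟩
    (if does (p u ≟ j) then degree G u else 0ℤ) - neighbours u j
      ≡⟨ cong (λ s → s - neighbours u j) (sym (∑-indicator u λ v → if does (p v ≟ j) then degree G u else 0ℤ)) ⟩
    ∑ (λ v → if does (u ≟ v) then (if does (p v ≟ j) then degree G u else 0ℤ) else 0ℤ) - neighbours u j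
      ≡⟨ sym (∑-distrib-- {order G} (λ v → if does (u ≟ v) then (if does (p v ≟ j) then degree G u else 0ℤ) else 0ℤ)
           (λ v → if does (p v ≟ j) then adjacency G u v else 0ℤ)) ⟩
    ∑ (λ v → (if does (u ≟ v) then (if does (p v ≟ j) then degree G u else 0ℤ) else 0ℤ) -
             (if does (p v ≟ j) then adjacency G u v else 0ℤ))
      ≡⟨ ∑-cong {order G} (λ v → restrict (does (u ≟ v)) (does (p v ≟ j)) (degree G u) (adjacency G u v)) ⟩
    ∑ (λ v → if does (p v ≟ j) then laplacian G u v else 0ℤ) ∎
    where
    open ≡-Reasoning
    restrict : ∀ (s t : Bool) d a →
      (if s then (if t then d else 0ℤ) else 0ℤ) - (if t then a else 0ℤ) ≡ (if t then (if s then d else 0ℤ) - a else 0ℤ)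
    restrict true  true  d a = refl
    restrict true  false d a = refl
    restrict false true  d a = refl
    restrict false false d a = refl

-- From the quotient matrix back to the graph

quotientMatrix-unique : ∀ {n k} {M : Matrix n} {π : Fin n → Fin k} {Q R : Matrix k} →
  (∀ j → ∃ λ u → π u ≡ j) → IsQuotientMatrix M π Q → IsQuotientMatrix M π R → ∀ i j → Q i j ≡ R i j
quotientMatrix-unique surj isQ isR i j with surj i
... | u , refl = trans (isQ u j) (sym (isR u j))

-- An eigenvector of `Q` is spread constantly over the fibres of `π`. Grouping the row sum of `M` by
-- fibres turns it into a row sum of `Q`.
quotient-eigenvalue : ∀ {n k} {M : Matrix n} {π : Fin n → Fin k} {Q : Matrix k} {μ} →
  (∀ j → ∃ λ u → π u ≡ j) → IsQuotientMatrix M π Q → IsEigenvalue Q μ → IsEigenvalue M μ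
quotient-eigenvalue {n} {k} {M} {π} {Q} {μ} surj isQ (v , (i , vi≢0) , eigen) =
  v ∘ π , (proj₁ (surj i) , vi≢0 ∘ trans (cong v (sym (proj₂ (surj i))))) , λ u → begin
    ∑ (λ w → M u w * v (π w))
      ≡⟨ ∑-cong {n} (λ w → sym (∑-indicator (π w) (λ j → M u w * v j))) ⟩
    ∑ (λ w → ∑ λ j → if does (π w ≟ j) then M u w * v j else 0ℤ)
      ≡⟨ ∑-comm {n} {k} (λ w j → if does (π w ≟ j) then M u w * v j else 0ℤ) ⟩
    ∑ (λ j → ∑ λ w → if does (π w ≟ j) then M u w * v j else 0ℤ)
      ≡⟨ ∑-cong {k} (λ j → trans (∑-cong {n} λ w → scale (does (π w ≟ j)) (M u w) (v j))
           (trans (sym (*-distribʳ-sum {n} (v j) (λ w → if does (π w ≟ j) then M u w else 0ℤ)))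
             (cong (λ q → q * v j) (sym (isQ u j))))) ⟩
    ∑ (λ j → Q (π u) j * v j)
      ≡⟨ eigen (π u) ⟩
    μ * v (π u) ∎
  where
  open ≡-Reasoning
  scale : ∀ (s : Bool) a b → (if s then a * b else 0ℤ) ≡ (if s then a else 0ℤ) * b
  scale true  a b = refl
  scale false a b = refl

-- Products of linear factors

∏-zeroFactor : ∀ {n} (f : Fin n → ℤ) i → f i ≡ 0ℤ → ∏ f ≡ 0ℤ
∏-zeroFactor {suc n} f zero    fi≡0 = cong (_* ∏ {n} (f ∘ suc)) fi≡0
∏-zeroFactor {suc n} f (suc i) fi≡0 =
  trans (cong (f zero *_) (∏-zeroFactor (f ∘ suc) i fi≡0)) (*-zeroʳ (f zero))

∏≡0⇒zeroFactor : ∀ {n} (f : Fin n → ℤ) → ∏ f ≡ 0ℤ → ∃ λ i → f i ≡ 0ℤ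
∏≡0⇒zeroFactor {suc n} f ∏f≡0 with i*j≡0⇒i≡0∨j≡0 (f zero) ∏f≡0
... | inj₁ f₀≡0 = zero , f₀≡0
... | inj₂ rest with ∏≡0⇒zeroFactor (f ∘ suc) rest
...   | i , fi≡0 = suc i , fi≡0

monic : ℕ → (ℕ → ℤ) → ℤ → ℤ
monic n f x = ∏ {n} λ i → x - f (toℕ i)

monic-root : ∀ {n} f i → i < n → monic n f (f i) ≡ 0ℤ
monic-root {n} f i i<n = ∏-zeroFactor (λ j → f i - f (toℕ j)) (fromℕ< i<n)
  (trans (cong (λ j → f i - f j) (toℕ-fromℕ< i<n)) (+-inverseʳ (f i)))

root-monic : ∀ {n} f x → monic n f x ≡ 0ℤ → ∃ λ i → i < n × x ≡ f i
root-monic f x P≡0 with ∏≡0⇒zeroFactor (λ j → x - f (toℕ j)) P≡0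
... | j , x-fj≡0 = toℕ j , toℕ<n j , i-j≡0⇒i≡j x (f (toℕ j)) x-fj≡0

-- The usual congruence for integer polynomials, obtained here by replacing `x` with `a` in one
-- linear factor at a time.
monic-congruent : ∀ n f x a → (x - a) ∣ℤ (monic n f x - monic n f a)
monic-congruent zero    f x a = dividesℤ 0ℤ refl
monic-congruent (suc n) f x a = subst ((x - a) ∣ℤ_) (telescope x a (f 0) _ _)
  (∣m∣n⇒∣m+n (∣m⇒∣m*n (monic n (f ∘ suc) x) ∣-refl) (∣n⇒∣m*n (a - f 0) (monic-congruent n (f ∘ suc) x a)))
  where
  telescope : ∀ x a c p q → (x - a) * p + (a - c) * (p - q) ≡ (x - c) * p - (a - c) * q
  telescope = solve-∀

-- If P and R agree off a, then every x - a ≠ 0 divides P a - R a.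
monic-cancel : ∀ n f g a → (∀ x → (x - a) * monic n f x ≡ (x - a) * monic n g x) →
  ∀ x → monic n f x ≡ monic n g x
monic-cancel n f g a eq x with x ℤₚ.≟ a
... | no  x≢a  = *-cancelˡ-≡ (x - a) _ _ {{≢-nonZero (x≢a ∘ i-j≡0⇒i≡j x a)}} (eq x)
... | yes refl = i-j≡0⇒i≡j _ _ (∣i∣≡0⇒i≡0 (small ∣ d ∣ d∣))
  where
  P = monic n f
  R = monic n g
  d = P a - R a
  -- Chosen so that `y - a` exceeds the absolute value of `d`; as it also divides `d`, this forces
  -- `d` to be 0.
  y = a + + suc ∣ d ∣
  y-a : ∀ a b → a + b - a ≡ b
  y-a = solve-∀
  Py≡Ry : P y ≡ R y
  Py≡Ry = *-cancelˡ-≡ (y - a) _ _ {{≢-nonZero λ y-a≡0 → contradiction (trans (sym (y-a a (+ suc ∣ d ∣))) y-a≡0) λ ()}} (eq y)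
  difference : ∀ p r q → (q - r) - (q - p) ≡ p - r
  difference = solve-∀
  d∣ : suc ∣ d ∣ ∣ ∣ d ∣
  d∣ = ∣⇒∣ᵤ (subst (_∣ℤ d) (y-a a (+ suc ∣ d ∣))
    (subst ((y - a) ∣ℤ_) (difference (P a) (R a) (P y))
      (∣m∣n⇒∣m-n (subst (λ z → (y - a) ∣ℤ (z - R a)) (sym Py≡Ry) (monic-congruent n g y a))
        (monic-congruent n f y a))))
  small : ∀ m → suc m ∣ m → m ≡ 0
  small zero    _     = refl
  small (suc m) 2+m∣1+m = contradiction 2+m∣1+m (>⇒∤ (ℕₚ.n<1+n (suc m)))

-- Uniqueness of sorted lists of roots

Sorted : ℕ → (ℕ → ℤ) → Set
Sorted n f = ∀ i → suc i < n → f i ℤ.≤ f (suc i)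

sorted-head : ∀ {n f} → Sorted n f → ∀ i → i < n → f 0 ℤ.≤ f i
sorted-head s zero    _   = ℤₚ.≤-refl
sorted-head s (suc i) i<n = ℤₚ.≤-trans (sorted-head s i (ℕₚ.<-trans (ℕₚ.n<1+n i) i<n)) (s i i<n)

-- Each head is the least root of its product and also a root of the other one, so the heads agree.
-- `monic-cancel` removes the common factor, and induction treats the tails.
sortedRoots-unique : ∀ n f g → Sorted n f → Sorted n g →
  (∀ x → monic n f x ≡ monic n g x) → ∀ i → i < n → f i ≡ g i
sortedRoots-unique (suc n) f g sf sg eq i i<n = go i i<n
  where
  head-≥ : ∀ {f g} → Sorted (suc n) g → (∀ x → monic (suc n) f x ≡ monic (suc n) g x) → g 0 ℤ.≤ f 0
  head-≥ {f} {g} sg eq with root-monic {suc n} g (f 0) (trans (sym (eq (f 0))) (monic-root {suc n} f 0 (s≤s z≤n)))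
  ... | j , j<n , f₀≡gj = ℤₚ.≤-trans (sorted-head sg j j<n) (ℤₚ.≤-reflexive (sym f₀≡gj))
  heads : f 0 ≡ g 0
  heads = ℤₚ.≤-antisym (head-≥ {g} {f} sf (sym ∘ eq)) (head-≥ {f} {g} sg eq)
  tails : ∀ x → monic n (f ∘ suc) x ≡ monic n (g ∘ suc) x
  tails = monic-cancel n (f ∘ suc) (g ∘ suc) (f 0) λ x →
    trans (eq x) (cong (λ a → (x - a) * monic n (g ∘ suc) x) (sym heads))
  go : ∀ i → i < suc n → f i ≡ g i
  go zero    _         = heads
  go (suc i) (s≤s i<n) = sortedRoots-unique n (f ∘ suc) (g ∘ suc)
    (λ j j<n → sf (suc j) (s≤s j<n)) (λ j j<n → sg (suc j) (s≤s j<n)) tails i i<n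

-- The ordered list of eigenvalues

even-double : ∀ h → even (h ℕ.* 2) ≡ true
even-double zero    = refl
even-double (suc h) rewrite even-double h = refl

joined-first : ∀ h → joined (suc h ℕ.* 2) 0 ≡ 0ℤ
joined-first h rewrite even-double h = refl

joined-second : ∀ h → joined (suc h ℕ.* 2) 1 ≡ 1ℤ
joined-second h rewrite even-double h = refl

-- With an even number of parts, `joined` alternates 0, 1, 0, 1, ... and has period two. The odd
-- positions selected here are the even indices of `α`, which start at 1.
∑-joined : ∀ h (c : ℕ → ℤ) →
  ∑ {h ℕ.* 2} (λ l → joined (h ℕ.* 2) (toℕ l) * c (toℕ l)) ≡ ∑ {h} λ l → c (suc (toℕ l ℕ.* 2))
∑-joined zero    c = refl
∑-joined (suc h) c = trans
  (cong₂ (λ a b → a * c 0 + (b * c 1 + ∑ {h ℕ.* 2} λ l → joined (h ℕ.* 2) (toℕ l) * c (2 ℕ.+ toℕ l))) (joined-first h) (joined-second h))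
  (trans (simplify (c 0) (c 1) _) (cong (_+_ (c 1)) (∑-joined h λ l → c (2 ℕ.+ l))))
  where
  simplify : ∀ x y t → 0ℤ * x + (1ℤ * y + t) ≡ y + t
  simplify = solve-∀

-- The upper half of the list. Two merges reproduce the situation with one pair of parts fewer and
-- first size `b 0 + b 1 + b 2`; regrouping moves `b 1` into the first sum.
root-even : ∀ h b t → t ≤ h → root (suc (h ℕ.* 2)) b (joined (suc h ℕ.* 2)) (t ℕ.* 2) ≡
  ∑ {suc h} (λ l → b (suc (toℕ l ℕ.* 2))) + ∑ {suc t} (λ l → b (toℕ l ℕ.* 2))
root-even h b zero t≤h = trans
  (cong₂ (λ a s → a * (b 0 + b 1) + s) (joined-second h) (∑-joined h λ l → b (2 ℕ.+ l)))
  (arrange (b 0) (b 1) (∑ {h} λ l → b (3 ℕ.+ toℕ l ℕ.* 2)))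
  where
  arrange : ∀ x y s → 1ℤ * (x + y) + s ≡ (y + s) + (x + 0ℤ)
  arrange = solve-∀
root-even (suc h) b (suc t) (s≤s t≤h) = trans (root-even h (merge (merge b)) t t≤h)
  (arrange (b 0) (b 1) (b 2) (∑ {suc h} λ l → b (3 ℕ.+ toℕ l ℕ.* 2)) (∑ {t} λ l → b (4 ℕ.+ toℕ l ℕ.* 2)))
  where
  arrange : ∀ x y z s u → s + (x + y + z + u) ≡ (y + s) + (x + (z + u))
  arrange = solve-∀

-- The lower half of the list, from its largest value down: at `t = h` the sum is empty, which is
-- the eigenvalue 0.
root-odd : ∀ h b t → t ≤ h → root (suc (h ℕ.* 2)) b (joined (suc h ℕ.* 2)) (suc (t ℕ.* 2)) ≡
  ∑ {h ∸ t} λ l → b (suc ((suc t ℕ.+ toℕ l) ℕ.* 2))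
root-odd zero    b zero t≤h = refl
root-odd (suc h) b zero t≤h = trans
  (cong (λ z → z + ∑ {suc (h ℕ.* 2)} λ l → joined (suc h ℕ.* 2) (suc (toℕ l)) * b (3 ℕ.+ toℕ l))
    -- The coefficient of the merged size is 0, so `b 2` may take its place and start the sum in
    -- `∑-joined`.
    (trans (cong (_* (b 0 + b 1 + b 2)) (joined-first h)) (sym (cong (_* b 2) (joined-first h)))))
  (∑-joined (suc h) λ l → b (2 ℕ.+ l))
root-odd (suc h) b (suc t) (s≤s t≤h) = root-odd h (merge (merge b)) t t≤h

index-reverse : ∀ s n i → i < n → suc s ℕ.+ (n ∸ suc i) ≡ s ℕ.+ n ∸ i
index-reverse s (suc n) i (s≤s i≤n) = trans
  (trans (sym (ℕₚ.+-suc s (n ∸ i))) (cong (s ℕ.+_) (sym (ℕₚ.+-∸-assoc 1 i≤n))))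
  (sym (ℕₚ.+-∸-assoc s (ℕₚ.m≤n⇒m≤1+n i≤n)))

module _ (α : ℕ → ℕ) (h : ℕ) where

  descending : ℕ → ℤ
  descending l = + α (h ℕ.* 2 ∸ 2 ℕ.* (l ∸ 1))

  -- The two halves of the explicit form for `k = h * 2`. `lowerValue 1` is the empty sum, hence 0,
  -- and `upperValue` takes the offset of the index from `h`.
  lowerValue upperValue eigenvalue : ℕ → ℤ
  lowerValue i = ∑₁ (i ∸ 1) descending
  upperValue t = ∑₁ h (λ l → + α (2 ℕ.* l)) + ∑₁ t (λ m → + α (2 ℕ.* m ∸ 1))
  eigenvalue i = if does (i ≤? h) then lowerValue i else upperValue (i ∸ h)

  eigenvalue-lower : ∀ {i} → i ≤ h → eigenvalue i ≡ lowerValue i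
  eigenvalue-lower {i} i≤h =
    cong (λ d → if d then lowerValue i else upperValue (i ∸ h)) (dec-true (i ≤? h) i≤h)

  eigenvalue-upper : ∀ t → eigenvalue (h ℕ.+ suc t) ≡ upperValue (suc t)
  eigenvalue-upper t = trans
    (cong (λ d → if d then lowerValue (h ℕ.+ suc t) else upperValue (h ℕ.+ suc t ∸ h))
      (dec-false (h ℕ.+ suc t ≤? h) (ℕₚ.m+1+n≰m h)))
    (cong upperValue (ℕₚ.m+n∸m≡n h (suc t)))

  ∑-descending : ∀ s n → s ℕ.+ n ≡ h →
    ∑ {n} (λ l → + α ((suc s ℕ.+ toℕ l) ℕ.* 2)) ≡ ∑₁ n descending
  ∑-descending s n s+n≡h = trans (Sum.sum-reverse n λ l → + α ((suc s ℕ.+ l) ℕ.* 2))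
    (∑-cong {n} λ i → cong (λ j → + α j) (index i))
    where
    index : ∀ (i : Fin n) → (suc s ℕ.+ (n ∸ suc (toℕ i))) ℕ.* 2 ≡ h ℕ.* 2 ∸ 2 ℕ.* toℕ i
    index i = trans
      (cong (ℕ._* 2) (trans (index-reverse s n (toℕ i) (toℕ<n i)) (cong (_∸ toℕ i) s+n≡h)))
      (trans (ℕₚ.*-distribʳ-∸ 2 h (toℕ i)) (cong (h ℕ.* 2 ∸_) (ℕₚ.*-comm (toℕ i) 2)))

  lowerValue-step : ∀ i → lowerValue (suc (suc i)) ≡ lowerValue (suc i) + descending (suc i)
  lowerValue-step i = Sum.sum-snoc i (descending ∘ suc)

  upperValue-step : ∀ t → upperValue (suc t) ≡ upperValue t + + α (2 ℕ.* suc t ∸ 1)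
  upperValue-step t = trans
    (cong (_+_ (∑₁ h λ l → + α (2 ℕ.* l))) (Sum.sum-snoc t λ m → + α (2 ℕ.* suc m ∸ 1)))
    (sym (ℤₚ.+-assoc (∑₁ h λ l → + α (2 ℕ.* l)) (∑₁ t λ m → + α (2 ℕ.* m ∸ 1)) _))

  upperValue-last : upperValue h ≡ ∑₁ (h ℕ.* 2) λ i → + α i
  upperValue-last = sym (trans (Sum.sum-interleave h λ i → + α (suc i)) (trans
    (ℤₚ.+-comm (∑ {h} λ i → + α (suc (toℕ i ℕ.* 2))) _)
    (cong₂ _+_
      (∑-cong {h} λ i → cong (λ j → + α j) (ℕₚ.*-comm (suc (toℕ i)) 2))
      (∑-cong {h} λ i → cong (λ j → + α (j ∸ 1)) (ℕₚ.*-comm (suc (toℕ i)) 2)))))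

data Position (h : ℕ) : ℕ → Set where
  below : ∀ {i} → i ≤ h → Position h i
  above : ∀ t → Position h (h ℕ.+ suc t)

position : ∀ h i → Position h i
position h i with i ≤? h
... | yes i≤h = below i≤h
... | no  i≰h with ℕₚ.m≤n⇒∃[o]m+o≡n (ℕₚ.≰⇒> i≰h)
...   | t , refl rewrite sym (ℕₚ.+-suc h t) = above t

double : ∀ h → h ℕ.* 2 ≡ h ℕ.+ h
double h = trans (ℕₚ.*-comm h 2) (cong (h ℕ.+_) (ℕₚ.+-identityʳ h))

half : ∀ h → h ℕ.* 2 / 2 ≡ h
half h = m*n/n≡m h 2

eigenvalue-recurrence : ∀ α h → Recurrence α (suc h ℕ.* 2) (eigenvalue α (suc h))
eigenvalue-recurrence α h′ = record
  { first = refl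
  ; last  = trans (cong (eigenvalue α h) (double h)) (trans (eigenvalue-upper α h h′) (upperValue-last α h))
  ; lower = lower
  ; upper = upper
  }
  where
  h = suc h′
  lower : ∀ i → 2 ≤ i → i ≤ h ℕ.* 2 / 2 →
    eigenvalue α h i ≡ eigenvalue α h (i ∸ 1) + + α (h ℕ.* 2 ∸ 2 ℕ.* (i ∸ 2))
  lower (suc (suc i)) (s≤s (s≤s _)) i≤k/2 = begin
    eigenvalue α h (suc (suc i))
      ≡⟨ eigenvalue-lower α h i≤h ⟩
    lowerValue α h (suc (suc i))
      ≡⟨ lowerValue-step α h i ⟩
    lowerValue α h (suc i) + descending α h (suc i)
      ≡⟨ cong (λ z → z + descending α h (suc i)) (sym (eigenvalue-lower α h (ℕₚ.≤-trans (ℕₚ.n≤1+n (suc i)) i≤h))) ⟩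
    eigenvalue α h (suc i) + descending α h (suc i) ∎
    where
    open ≡-Reasoning
    i≤h = subst (suc (suc i) ≤_) (half h) i≤k/2
  -- For `i = h + suc t` the index in the recurrence is that of the last summand of `upperValue` at
  -- `suc (suc t)`.
  index : ∀ t → 2 ℕ.* suc (suc t) ∸ 1 ≡ 2 ℕ.* (h ℕ.+ suc t) ∸ (h ℕ.* 2 ∸ 1)
  index t = sym (trans (cong (_∸ suc (h′ ℕ.* 2)) (arrange h′ t)) (ℕₚ.m+n∸m≡n (suc (h′ ℕ.* 2)) (2 ℕ.* suc (suc t) ∸ 1)))
    where
    arrange : ∀ h t → 2 ℕ.* (suc h ℕ.+ suc t) ≡ suc (h ℕ.* 2) ℕ.+ (suc t ℕ.+ (suc (suc t) ℕ.+ 0))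
    arrange = ℕ-solve-∀
  move : ∀ {a b} c → a ≡ b + c → b ≡ a - c
  move {a} {b} c refl = cancel b c
    where
    cancel : ∀ b c → b ≡ b + c - c
    cancel = solve-∀
  upper : ∀ i → h ℕ.* 2 / 2 ℕ.+ 1 ≤ i → i ≤ h ℕ.* 2 ∸ 1 →
    eigenvalue α h i ≡ eigenvalue α h (i ℕ.+ 1) - + α (2 ℕ.* i ∸ (h ℕ.* 2 ∸ 1))
  upper i k/2<i _ with position h i
  ... | below i≤h = contradiction i≤h (ℕₚ.<⇒≱ (subst (_≤ i) (trans (cong (ℕ._+ 1) (half h)) (ℕₚ.+-comm h 1)) k/2<i))
  -- The recurrence descends from `i + 1` to `i` whereas `upperValue-step` ascends; `move` turns one
  -- into the other.
  ... | above t   = move (+ α (2 ℕ.* (h ℕ.+ suc t) ∸ (h ℕ.* 2 ∸ 1))) (begin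
    eigenvalue α h (h ℕ.+ suc t ℕ.+ 1)
      ≡⟨ cong (eigenvalue α h) (trans (ℕₚ.+-assoc h (suc t) 1) (cong (h ℕ.+_) (ℕₚ.+-comm (suc t) 1))) ⟩
    eigenvalue α h (h ℕ.+ suc (suc t))
      ≡⟨ eigenvalue-upper α h (suc t) ⟩
    upperValue α h (suc (suc t))
      ≡⟨ upperValue-step α h (suc t) ⟩
    upperValue α h (suc t) + + α (2 ℕ.* suc (suc t) ∸ 1)
      ≡⟨ cong₂ (λ z j → z + + α j) (sym (eigenvalue-upper α h t)) (index t) ⟩
    eigenvalue α h (h ℕ.+ suc t) + + α (2 ℕ.* (h ℕ.+ suc t) ∸ (h ℕ.* 2 ∸ 1)) ∎)
    where open ≡-Reasoning

eigenvalue-sorted : ∀ α h i → 1 ≤ i → eigenvalue α (suc h) i ℤ.≤ eigenvalue α (suc h) (suc i)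
eigenvalue-sorted α h′ i 1≤i = ordered i 1≤i (position h i)
  where
  open ℤₚ.≤-Reasoning
  h = suc h′
  ordered : ∀ i → 1 ≤ i → Position h i → eigenvalue α h i ℤ.≤ eigenvalue α h (suc i)
  ordered _ _ (above t) = begin
    eigenvalue α h (h ℕ.+ suc t)
      ≡⟨ eigenvalue-upper α h t ⟩
    upperValue α h (suc t)
      ≤⟨ i≤i+j (upperValue α h (suc t)) (+ α (2 ℕ.* suc (suc t) ∸ 1)) ⟩
    upperValue α h (suc t) + + α (2 ℕ.* suc (suc t) ∸ 1)
      ≡⟨ sym (trans (eigenvalue-upper α h (suc t)) (upperValue-step α h (suc t))) ⟩
    eigenvalue α h (h ℕ.+ suc (suc t))
      ≡⟨ cong (eigenvalue α h) (ℕₚ.+-suc h (suc t)) ⟩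
    eigenvalue α h (suc (h ℕ.+ suc t)) ∎
  ordered (suc i) _ (below i≤h) with ℕₚ.m≤n⇒m<n∨m≡n i≤h
  ... | inj₁ i<h = begin
    eigenvalue α h (suc i)
      ≡⟨ eigenvalue-lower α h i≤h ⟩
    lowerValue α h (suc i)
      ≤⟨ i≤i+j (lowerValue α h (suc i)) (descending α h (suc i)) ⟩
    lowerValue α h (suc i) + descending α h (suc i)
      ≡⟨ sym (trans (eigenvalue-lower α h i<h) (lowerValue-step α h i)) ⟩
    eigenvalue α h (suc (suc i)) ∎
  -- At the middle, two non-negative terms separate the neighbours: `α 2` completes the sum over
  -- even indices, and `α 1` starts the sum over odd ones.
  ... | inj₂ refl = begin
    eigenvalue α h h
      ≡⟨ eigenvalue-lower α h ℕₚ.≤-refl ⟩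
    lowerValue α h h
      ≤⟨ i≤i+j (lowerValue α h h) (descending α h h) ⟩
    lowerValue α h h + descending α h h
      ≡⟨ sym (Sum.sum-snoc h′ (descending α h ∘ suc)) ⟩
    ∑₁ h (descending α h)
      ≡⟨ sym (∑-descending α h 0 h refl) ⟩
    ∑ {h} (λ l → + α (suc (toℕ l) ℕ.* 2))
      ≡⟨ ∑-cong {h} (λ l → cong (λ j → + α j) (ℕₚ.*-comm (suc (toℕ l)) 2)) ⟩
    ∑₁ h (λ l → + α (2 ℕ.* l))
      ≤⟨ i≤i+j (∑₁ h (λ l → + α (2 ℕ.* l))) (+ α 1) ⟩
    ∑₁ h (λ l → + α (2 ℕ.* l)) + + α 1
      ≡⟨ cong (_+_ (∑₁ h (λ l → + α (2 ℕ.* l)))) (sym (+-identityʳ (+ α 1))) ⟩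
    upperValue α h 1
      ≡⟨ sym (eigenvalue-upper α h 0) ⟩
    eigenvalue α h (h ℕ.+ 1)
      ≡⟨ cong (eigenvalue α h) (ℕₚ.+-comm h 1) ⟩
    eigenvalue α h (suc h) ∎

-- Even positions list the upper half in ascending order, odd positions the lower half in descending
-- order. Interleaving, one reversal and concatenation sort the factors.
monic-eigenvalue : ∀ α h x →
  monic (suc h ℕ.* 2) (root (suc (h ℕ.* 2)) (partSize α) (joined (suc h ℕ.* 2))) x ≡
  ∏₁ (suc h ℕ.* 2) λ i → x - eigenvalue α (suc h) i
monic-eigenvalue α h′ x = begin
  monic (h ℕ.* 2) ρ x
    ≡⟨ Prod.sum-interleave h (λ i → x - ρ i) ⟩
  ∏ {h} (λ t → x - ρ (toℕ t ℕ.* 2)) * ∏ {h} (λ t → x - ρ (suc (toℕ t ℕ.* 2)))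
    ≡⟨ ℤₚ.*-comm (∏ {h} λ t → x - ρ (toℕ t ℕ.* 2)) _ ⟩
  ∏ {h} (λ t → x - ρ (suc (toℕ t ℕ.* 2))) * ∏ {h} (λ t → x - ρ (toℕ t ℕ.* 2))
    ≡⟨ cong₂ _*_ (∏-cong {h} λ t → cong (_-_ x) (odd (toℕ t) (ℕₚ.≤-pred (toℕ<n t))))
         (∏-cong {h} λ t → cong (_-_ x) (evn (toℕ t) (ℕₚ.≤-pred (toℕ<n t)))) ⟩
  ∏ {h} (λ t → x - eigenvalue α h (suc (h ∸ suc (toℕ t)))) * ∏ {h} (λ t → x - eigenvalue α h (suc (h ℕ.+ toℕ t)))
    ≡⟨ cong (_* ∏ {h} (λ t → x - eigenvalue α h (suc (h ℕ.+ toℕ t))))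
         (sym (Prod.sum-reverse h λ i → x - eigenvalue α h (suc i))) ⟩
  ∏₁ h (λ i → x - eigenvalue α h i) * ∏ {h} (λ t → x - eigenvalue α h (suc (h ℕ.+ toℕ t)))
    ≡⟨ sym (Prod.sum-+ h {h} λ i → x - eigenvalue α h (suc i)) ⟩
  ∏₁ (h ℕ.+ h) (λ i → x - eigenvalue α h i)
    ≡⟨ cong (λ n → ∏₁ n λ i → x - eigenvalue α h i) (sym (double h)) ⟩
  ∏₁ (h ℕ.* 2) (λ i → x - eigenvalue α h i) ∎
  where
  open ≡-Reasoning
  h = suc h′
  ρ = root (suc (h′ ℕ.* 2)) (partSize α) (joined (h ℕ.* 2))
  evn : ∀ t → t ≤ h′ → ρ (t ℕ.* 2) ≡ eigenvalue α h (suc (h ℕ.+ t))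
  evn t t≤h′ = begin
    ρ (t ℕ.* 2)
      ≡⟨ root-even h′ (partSize α) t t≤h′ ⟩
    ∑ {h} (λ l → + α (suc (toℕ l) ℕ.* 2)) + ∑ {suc t} (λ l → + α (suc (toℕ l) ℕ.* 2 ∸ 1))
      ≡⟨ cong₂ _+_ (∑-cong {h} λ l → cong (λ j → + α j) (ℕₚ.*-comm (suc (toℕ l)) 2))
           (∑-cong {suc t} λ l → cong (λ j → + α (j ∸ 1)) (ℕₚ.*-comm (suc (toℕ l)) 2)) ⟩
    upperValue α h (suc t)
      ≡⟨ sym (eigenvalue-upper α h t) ⟩
    eigenvalue α h (h ℕ.+ suc t)
      ≡⟨ cong (eigenvalue α h) (ℕₚ.+-suc h t) ⟩
    eigenvalue α h (suc (h ℕ.+ t)) ∎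
  odd : ∀ t → t ≤ h′ → ρ (suc (t ℕ.* 2)) ≡ eigenvalue α h (suc (h ∸ suc t))
  odd t t≤h′ = begin
    ρ (suc (t ℕ.* 2))
      ≡⟨ root-odd h′ (partSize α) t t≤h′ ⟩
    ∑ {h′ ∸ t} (λ l → + α ((suc (suc t) ℕ.+ toℕ l) ℕ.* 2))
      ≡⟨ ∑-descending α h (suc t) (h′ ∸ t) (cong suc (ℕₚ.m+[n∸m]≡n t≤h′)) ⟩
    lowerValue α h (suc (h′ ∸ t))
      ≡⟨ sym (eigenvalue-lower α h (s≤s (ℕₚ.m∸n≤m h′ t))) ⟩
    eigenvalue α h (suc (h′ ∸ t)) ∎

-- Solutions of the recurrence and lists of eigenvalues

AgreeUpTo : ℕ → (μ ν : ℕ → ℤ) → Set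
AgreeUpTo k μ ν = ∀ i → 1 ≤ i → i ≤ k → μ i ≡ ν i

-- The lower half is determined upwards from `first`, the upper half downwards from `last`.
recurrence-unique : ∀ {α h μ ν} → Recurrence α (suc h ℕ.* 2) μ → Recurrence α (suc h ℕ.* 2) ν →
  AgreeUpTo (suc h ℕ.* 2) μ ν
recurrence-unique {α} {h′} {μ} {ν} R S i 1≤i i≤k with position (suc h′) i
... | below i≤h = low i 1≤i i≤h
  where
  low : ∀ i → 1 ≤ i → i ≤ suc h′ → μ i ≡ ν i
  low (suc zero)    _ _   = trans (Recurrence.first R) (sym (Recurrence.first S))
  low (suc (suc i)) _ i≤h = trans (Recurrence.lower R _ (s≤s (s≤s z≤n)) i≤k/2)
    (trans (cong (λ z → z + + α (suc h′ ℕ.* 2 ∸ 2 ℕ.* i)) (low (suc i) (s≤s z≤n) (ℕₚ.≤-trans (ℕₚ.n≤1+n _) i≤h)))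
      (sym (Recurrence.lower S _ (s≤s (s≤s z≤n)) i≤k/2)))
    where i≤k/2 = subst (suc (suc i) ≤_) (sym (half (suc h′))) i≤h
... | above t = high (k ∸ (suc h′ ℕ.+ suc t)) (suc h′ ℕ.+ suc t) (ℕₚ.m+[n∸m]≡n i≤k)
    (subst (λ z → z ℕ.+ 1 ≤ suc h′ ℕ.+ suc t) (sym (half (suc h′))) (ℕₚ.+-monoʳ-≤ (suc h′) (s≤s z≤n)))
  where
  k = suc h′ ℕ.* 2
  -- Induction on the distance `d` from `i` to `k`, as the upper recurrence refers to `i + 1`.
  high : ∀ d i → i ℕ.+ d ≡ k → k / 2 ℕ.+ 1 ≤ i → μ i ≡ ν i
  high zero    i i≡k _ rewrite ℕₚ.+-identityʳ i | i≡k = trans (Recurrence.last R) (sym (Recurrence.last S))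
  high (suc d) i i+1+d≡k k/2<i = trans (Recurrence.upper R i k/2<i i<k)
    (trans (cong (λ z → z - + α (2 ℕ.* i ∸ (k ∸ 1)))
      (high d (i ℕ.+ 1) (trans (ℕₚ.+-assoc i 1 d) i+1+d≡k) (ℕₚ.≤-trans k/2<i (ℕₚ.m≤m+n i 1))))
      (sym (Recurrence.upper S i k/2<i i<k)))
    where
    i<k : i ≤ k ∸ 1
    i<k = ℕₚ.≤-pred (subst (suc i ≤_) i+1+d≡k
      (subst (suc i ≤_) (sym (ℕₚ.+-suc i d)) (s≤s (ℕₚ.m≤m+n i d))))

recurrence-resp : ∀ {α h μ ν} → AgreeUpTo (suc h ℕ.* 2) μ ν →
  Recurrence α (suc h ℕ.* 2) ν → Recurrence α (suc h ℕ.* 2) μ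
recurrence-resp {α} {h′} {μ} {ν} μ≡ν R = record
  { first = trans (μ≡ν 1 ℕₚ.≤-refl (s≤s z≤n)) (Recurrence.first R)
  ; last  = trans (μ≡ν k (s≤s z≤n) ℕₚ.≤-refl) (Recurrence.last R)
  ; lower = λ i 2≤i i≤k/2 →
      let i≤k = ℕₚ.≤-trans i≤k/2 (m/n≤m k 2) in
      trans (μ≡ν i (ℕₚ.≤-trans (s≤s z≤n) 2≤i) i≤k) (trans (Recurrence.lower R i 2≤i i≤k/2)
        (cong (λ z → z + + α (k ∸ 2 ℕ.* (i ∸ 2)))
          (sym (μ≡ν (i ∸ 1) (ℕₚ.∸-monoˡ-≤ 1 2≤i) (ℕₚ.≤-trans (ℕₚ.m∸n≤m i 1) i≤k)))))
  ; upper = λ i k/2<i i<k →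
      let 1≤i = ℕₚ.≤-trans (ℕₚ.m≤n+m 1 (k / 2)) k/2<i in
      trans (μ≡ν i 1≤i (ℕₚ.≤-trans i<k (ℕₚ.m∸n≤m k 1))) (trans (Recurrence.upper R i k/2<i i<k)
        (cong (λ z → z - + α (2 ℕ.* i ∸ (k ∸ 1)))
          (sym (μ≡ν (i ℕ.+ 1) (ℕₚ.m≤n+m 1 i) (subst (_≤ k) (ℕₚ.+-comm 1 i) (s≤s i<k))))))
  }
  where k = suc h′ ℕ.* 2

eigenvaluesListedAs-resp : ∀ {n} {M : Matrix n} {μ ν} → AgreeUpTo n μ ν →
  EigenvaluesListedAs M ν → EigenvaluesListedAs M μ
eigenvaluesListedAs-resp {n} μ≡ν L = record
  { sorted = λ i 1≤i i<n → subst₂ ℤ._≤_ (sym (μ≡ν i 1≤i (ℕₚ.<⇒≤ i<n))) (sym (μ≡ν (suc i) (s≤s z≤n) i<n))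
      (EigenvaluesListedAs.sorted L i 1≤i i<n)
  ; splits = λ x → trans (EigenvaluesListedAs.splits L x)
      (∏-cong {n} λ i → cong (_-_ x) (sym (μ≡ν (suc (toℕ i)) (s≤s z≤n) (toℕ<n i))))
  }

eigenvaluesListedAs-unique : ∀ {n} {M : Matrix n} {μ ν} →
  EigenvaluesListedAs M μ → EigenvaluesListedAs M ν → AgreeUpTo n μ ν
eigenvaluesListedAs-unique {n} {μ = μ} {ν} L L′ (suc i) _ i<n =
  sortedRoots-unique n (μ ∘ suc) (ν ∘ suc)
    (λ j → EigenvaluesListedAs.sorted L (suc j) (s≤s z≤n))
    (λ j → EigenvaluesListedAs.sorted L′ (suc j) (s≤s z≤n))
    (λ x → trans (sym (EigenvaluesListedAs.splits L x)) (EigenvaluesListedAs.splits L′ x)) i i<n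

explicitForm : ∀ {α h μ} → AgreeUpTo (suc h ℕ.* 2) μ (eigenvalue α (suc h)) → ExplicitForm α (suc h ℕ.* 2) μ
explicitForm {α} {h′} {μ} μ≡ = record { lower = lower ; upper = upper }
  where
  h = suc h′
  k = h ℕ.* 2
  lower : ∀ i → 2 ≤ i → i ≤ k / 2 → μ i ≡ lowerValue α h i
  lower i 2≤i i≤k/2 = trans (μ≡ i (ℕₚ.≤-trans (s≤s z≤n) 2≤i) (ℕₚ.≤-trans i≤k/2 (m/n≤m k 2)))
    (eigenvalue-lower α h (subst (i ≤_) (half h) i≤k/2))
  upper : ∀ i → 1 ≤ i → i ≤ k / 2 → μ (k / 2 ℕ.+ i) ≡
    ∑₁ (k / 2) (λ l → + α (2 ℕ.* l)) + ∑₁ i (λ m → + α (2 ℕ.* m ∸ 1))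
  upper (suc i) _ i≤k/2 rewrite half h =
    trans (μ≡ (h ℕ.+ suc i) (s≤s z≤n) (subst (h ℕ.+ suc i ≤_) (sym (double h)) (ℕₚ.+-monoʳ-≤ h i≤k/2)))
      (eigenvalue-upper α h i)

-- The spectrum of the quotient matrix and its place in the Laplacian spectrum

theorem2p1 : (k : ℕ) → 2 ≤ k → 2 ∣ k →
    (α : ℕ → ℕ) → (∀ i → 1 ≤ i → i ≤ k → 0 < α i) →
    ∃ (IsQuotientMatrix (laplacian (C α k)) (part α k)) ×
    (∀ Q → IsQuotientMatrix (laplacian (C α k)) (part α k) Q →
    (∃ λ μ → EigenvaluesListedAs Q μ) ×
    (∀ (μ : ℕ → ℤ) → EigenvaluesListedAs Q μ ⇔ Recurrence α k μ) ×
    (∀ (μ : ℕ → ℤ) → EigenvaluesListedAs Q μ →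
    ExplicitForm α k μ ×
    (∀ i → 1 ≤ i → i ≤ k → IsEigenvalue (laplacian (C α k)) (μ i))))
theorem2p1 _ () (divides zero refl)
-- Evenness presents `k` as `suc h * 2`; thus `suc h` is half the number of parts, and `n` is
-- `k - 1`.
theorem2p1 _ _  (divides (suc h) refl) α α>0 =
  (quotient α n , isQuotient) , λ Q isQ →
    let
      Q≡ = quotientMatrix-unique {M = laplacian (C α k)} {Q = Q} {quotient α n} surj isQ isQuotient
      charPolyQ : ∀ x → charPoly Q x ≡ monic k ρ x
      charPolyQ x = trans (charPoly-cong Q≡ x)
        (charPoly-weightedLaplacian n (partSize α) (joined k) x)
      listed : EigenvaluesListedAs Q (eigenvalue α (suc h))
      listed = record
        { sorted = λ i 1≤i _ → eigenvalue-sorted α h i 1≤i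
        ; splits = λ x → trans (charPolyQ x) (monic-eigenvalue α h x)
        }
      recurrence = eigenvalue-recurrence α h
    in
    (eigenvalue α (suc h) , listed) ,
    (λ μ → mk⇔
      (λ L → recurrence-resp {h = h} (eigenvaluesListedAs-unique L listed) recurrence)
      (λ R → eigenvaluesListedAs-resp (recurrence-unique {h = h} R recurrence) listed)) ,
    (λ μ L → explicitForm {h = h} (eigenvaluesListedAs-unique L listed) , λ
      -- By `splits`, the value `μ (suc i)` is a zero of the characteristic polynomial, hence one of
      -- the roots `ρ m`, for which an eigenvector is known.
      { (suc i) _ i<k → eigen (μ (suc i)) (trans (sym (charPolyQ (μ (suc i))))
          (trans (EigenvaluesListedAs.splits L (μ (suc i))) (monic-root (μ ∘ suc) i i<k))) })
  where
  n = suc (h ℕ.* 2)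
  k = suc n
  ρ = root n (partSize α) (joined k)
  isQuotient = quotient-isQuotientMatrix α n
  surj = part-surjective α k α>0
  size≢0 : ∀ i → i < n → partSize α (suc i) ≢ 0ℤ
  size≢0 i i<n eq = ℕₚ.<⇒≢ (α>0 (2 ℕ.+ i) (s≤s z≤n) (s≤s i<n)) (sym (+-injective eq))
  eigen : ∀ x → monic k ρ x ≡ 0ℤ → IsEigenvalue (laplacian (C α k)) x
  eigen x P≡0 with root-monic ρ x P≡0
  ... | m , s≤s m≤n , refl with weightedEigenvector n (partSize α) (joined k) size≢0 m m≤n
  ...   | v , v≢0 , Wv≡ = quotient-eigenvalue {M = laplacian (C α k)} {Q = quotient α n} {ρ m} surj isQuotient
    (v , v≢0 , λ i → trans (weightedLaplacian-apply (partSize α) (joined k) v i) (Wv≡ i))
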